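{- For any integers $g \geq h \geq 2$ and any integer $n \geq 1$, there exists a set $A \subset [n]$ that is a weak $C_h[g]$-set in $\mathbb{Z}$ and satisfies $$|A| \geq \frac{1}{8}\, n^{\left(1 - \frac{1}{h}\right)\left(1 - \frac{1}{g}\right)\left(1 + \frac{1}{hg-1}\right)}.$$
   Context: $[n] = \{1,2,\dots,n\}$. Let $\Gamma$ be an abelian group and $g \geq h \geq 2$ integers. A set $A \subset \Gamma$ is a weak $C_h[g]$-set if, for any set $X \subset \Gamma$ with $|X| = h$ and any set $\{k_1,\dots,k_g\} \subset \Gamma$ of $g$ distinct elements such that the translates $X + k_1, \dots, X + k_g$ are pairwise disjoint, at least one of the translates $X + k_i := \{x + k_i : x \in X\}$ is not contained in $A$. Here $\Gamma = \mathbb{Z}$. -}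

module Defs where

open import Algebra.Bundles using (AbelianGroup)
open import Data.Fin.Base using (Fin)
open import Data.Integer.Base as ℤ using (ℤ; +_; -[1+_])
open import Data.Nat.Base using (ℕ; suc; _*_; _∸_; _^_; _≤_; NonZero; >-nonZero)
open import Data.Nat.Properties using (≤-trans; n≤1+n; *-mono-≤; m<n⇒0<n∸m)
open import Data.Product.Base using (Σ-syntax; ∃-syntax; _×_)
open import Data.Rational.Unnormalised.Base as ℚᵘ using (ℚᵘ; mkℚᵘ; 1ℚᵘ)
open import Function.Bundles using (_⇔_)
open import Function.Definitions using (Injective)
open import Level using (Level; 0ℓ; _⊔_) renaming (suc to lsuc)
open import Relation.Binary.PropositionalEquality.Core using (_≡_; _≢_)
open import Relation.Nullary.Negation.Core using (¬_)
open import Relation.Unary using (Pred; _∈_; _⊆_; _⊥_)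

module _ {c ℓ : Level} (Γ : AbelianGroup c ℓ) where
  open AbelianGroup Γ using (Carrier; _≈_; _∙_)

  Distinct : {n : ℕ} → (Fin n → Carrier) → Set ℓ
  Distinct = Injective _≡_ _≈_

  -- |X| = n: X consists exactly of the terms of an n-term sequence without
  -- repetitions (so X automatically respects ≈).
  HasSize : {p : Level} → Pred Carrier p → ℕ → Set (c ⊔ ℓ ⊔ p)
  HasSize X n =
    Σ[ f ∈ (Fin n → Carrier) ] Distinct f × (∀ x → x ∈ X ⇔ (∃[ i ] x ≈ f i))

  Translate : {p : Level} → Pred Carrier p → Carrier → Pred Carrier (c ⊔ ℓ ⊔ p)
  Translate X k z = ∃[ x ] x ∈ X × z ≈ x ∙ k

  -- Sets X at level ℓ suffice: a set of size h is the image of a finite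
  -- sequence, and such images live at level ℓ.
  IsWeakC : {p : Level} → (h g : ℕ) → Pred Carrier p → Set (c ⊔ lsuc ℓ ⊔ p)
  IsWeakC h g A =
    (X : Pred Carrier ℓ) → HasSize X h →
    (k : Fin g → Carrier) → Distinct k →
    (∀ i j → i ≢ j → Translate X (k i) ⊥ Translate X (k j)) →
    ∃[ i ] ¬ (Translate X (k i) ⊆ A)

[1⋯_] : ℕ → Pred ℤ 0ℓ
[1⋯ n ] x = (+ 1) ℤ.≤ x × x ℤ.≤ (+ n)

-- The comparison b ^ r ≤ y of the real power b ^ r with y, for b ≥ 1 and
-- rational r: since t ↦ t ^ q is strictly increasing on t ≥ 0, the inequality
-- b ^ (p / q) ≤ y means b ^ p ≤ y ^ q, and b ^ (- p / q) ≤ y means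
-- 1 ≤ y ^ q * b ^ p.  Neither depends on the fraction chosen to represent r.
infix 4 _^ℚ_≤_
_^ℚ_≤_ : ℕ → ℚᵘ → ℕ → Set
b ^ℚ mkℚᵘ (+ p)    q-1 ≤ y = b ^ p ≤ y ^ suc q-1
b ^ℚ mkℚᵘ -[1+ p ] q-1 ≤ y = 1 ≤ y ^ suc q-1 * b ^ suc p

-- (1 - 1/h) (1 - 1/g) (1 + 1/(hg - 1)); the hypotheses only serve to make the
-- denominators nonzero.
exponent : (h g : ℕ) → 2 ≤ h → h ≤ g → ℚᵘ
exponent h g 2≤h h≤g =
  (1ℚᵘ ℚᵘ.- (+ 1 ℚᵘ./ h)) ℚᵘ.* (1ℚᵘ ℚᵘ.- (+ 1 ℚᵘ./ g))
    ℚᵘ.* (1ℚᵘ ℚᵘ.+ (+ 1 ℚᵘ./ (h * g ∸ 1)))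
  where
  1≤h : 1 ≤ h
  1≤h = ≤-trans (n≤1+n 1) 2≤h

  1≤g : 1 ≤ g
  1≤g = ≤-trans 1≤h h≤g

  instance
    h≢0 : NonZero h
    h≢0 = >-nonZero 1≤h

    g≢0 : NonZero g
    g≢0 = >-nonZero 1≤g

    hg-1≢0 : NonZero (h * g ∸ 1)
    hg-1≢0 = >-nonZero (m<n⇒0<n∸m (*-mono-≤ 2≤h 1≤g))

{-# OPTIONS --safe #-}

-- For k = hg - 1 and s = h + g - 2 the exponent equals 1 - s/k.  A grid X + K
-- with hg distinct points in [n] is determined by its h + g - 1 points x + k₁
-- and x₁ + k, so there are at most n^(s+1) of them, and A only has to contain
-- none.  Keeping each point of [n] with probability 1/t, then deleting one
-- point of every surviving grid, leaves at least n/t - n^(s+1)/t^(k+1) points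
-- on average; choose t least with t^k ≥ 2 n^s.  The random choice is
-- derandomised by conditional expectations.
module Submission where

open import Defs
import Algebra.Properties.AbelianGroup
import Algebra.Properties.CommutativeMonoid.Sum
import Algebra.Properties.Semiring.Sum
open import Data.Fin.Base using (Fin; zero; suc; toℕ; _↑ˡ_; _↑ʳ_; remQuot; combine; splitAt; finToFun; funToFin)
open import Data.Fin.Properties
  using (any?; all?; injective⇒≤; finToFun-funToFin; combine-remQuot; splitAt-↑ˡ; splitAt-↑ʳ; ¬∀⟶∃¬;
         toℕ-injective; toℕ<n; suc-injective)
  renaming (_≟_ to _≟ᶠ_)
open import Data.Fin.Subset using (Subset; Side; Nonempty; inside; outside; _∈_; ∣_∣; _-_)
  renaming (_⊆_ to _⊆ₛ_; _⊈_ to _⊈ₛ_)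
open import Data.Fin.Subset.Properties
  using (p─q⊆p; p─⊥≡p; _⊆?_; _∈?_; drop-∷-⊆; ⊆-refl; ⊆-trans; nonempty?; Empty-unique; ∣⊥∣≡0)
open import Data.Integer.Base as ℤ using (ℤ; -[1+_])
open import Data.Integer.Properties as ℤ using (+-0-abelianGroup)
import Data.Integer.Tactic.RingSolver as ℤ-Solver
open import Data.Nat.Base hiding (∣_-_∣)
open import Data.Nat.Properties hiding (suc-injective)
open import Data.Nat.Tactic.RingSolver using (solve-∀)
open import Data.Product.Base using (Σ-syntax; ∃-syntax; _×_; _,_; proj₁; proj₂; uncurry)
open import Data.Rational.Unnormalised.Base as ℚᵘ using (mkℚᵘ; 1ℚᵘ; *≡*)
import Data.Rational.Unnormalised.Properties as ℚᵘ
open import Data.Sum.Base using ([_,_]′)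
open import Data.Vec.Base using ([]; _∷_; tabulate; here; there; head; tail)
open import Data.Vec.Properties using (lookup∘tabulate; []=⇒lookup; lookup⇒[]=)
open import Function.Base using (_∘_)
open import Function.Bundles using (mk⇔; Equivalence)
open import Function.Definitions using (Injective)
open import Level using (0ℓ)
open import Relation.Binary.PropositionalEquality
  using (_≡_; refl; sym; trans; cong; cong₂; subst; subst₂; module ≡-Reasoning)
open import Relation.Nullary using (Dec; yes; no; ¬_; contradiction; does)
open import Relation.Nullary.Decidable using (dec-true; _×-dec_)
open import Relation.Unary using (Pred; _⊆_)

open Algebra.Properties.CommutativeMonoid.Sum +-0-commutativeMonoid using (sum; ∑-distrib-+; sum-cong-≗)
open Algebra.Properties.Semiring.Sum +-*-semiring using (*-distribˡ-sum)
module ℤ-Group = Algebra.Properties.AbelianGroup +-0-abelianGroup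

private variable
  n N H G : ℕ

-- Random subsets by conditional expectations.

sum-1 : ∀ N → sum {N} (λ _ → 1) ≡ N
sum-1 zero = refl
sum-1 (suc N) = cong suc (sum-1 N)

module _ (t′ : ℕ) where
  private t = suc t′

  factor : Side → Side → ℕ
  factor outside _ = 1
  factor inside inside = t
  factor inside outside = 0

  -- t^|e| if e ⊆ S and 0 otherwise: the indicator of e ⊆ S, divided by the
  -- probability of that event.
  weight : Subset n → Subset n → ℕ
  weight [] [] = 1
  weight (b ∷ e) (s ∷ S) = factor b s * weight e S

  -- The share of one edge in the total weight of the edges through the point being decided; the
  -- side tells whether the edge contains that point.
  mark : Side → ℕ → ℕ
  mark inside w = w
  mark outside w = 0

  weight-⊆ : (e S : Subset n) → e ⊆ₛ S → weight e S ≡ t ^ ∣ e ∣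
  weight-⊆ [] [] _ = refl
  weight-⊆ (outside ∷ e) (s ∷ S) e⊆S = trans (*-identityˡ (weight e S)) (weight-⊆ e S (drop-∷-⊆ e⊆S))
  weight-⊆ (inside ∷ e) (s ∷ S) e⊆S with here ← e⊆S here = cong (t *_) (weight-⊆ e S (drop-∷-⊆ e⊆S))

  -- Keeping a point multiplies the weight of every edge through it by `t`. The term `mark b w`
  -- stands on the left to avoid subtraction in ℕ.
  factor-inside : ∀ (b : Side) w → w * factor b inside + mark b w ≡ w + t * mark b w
  factor-inside inside w = p t w
    where p : ∀ t w → w * t + w ≡ w + t * w
          p = solve-∀
  factor-inside outside w = p t w
    where p : ∀ t w → w * 1 + 0 ≡ w + t * 0
          p = solve-∀

  factor-outside : ∀ (b : Side) w → w * factor b outside + mark b w ≡ w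
  factor-outside inside w = cong (_+ w) (*-zeroʳ w)
  factor-outside outside w = trans (+-identityʳ (w * 1)) (*-identityʳ w)

  -- c t |S| - Σ wᵢ weight(eᵢ, S) has expectation c n - Σ wᵢ.  The points are
  -- decided one at a time: keeping a point pays iff the current total weight
  -- of the edges through it is at most c.
  ∃-above-average : ∀ c (w : Fin N → ℕ) (e : Fin N → Subset n) →
    ∃[ S ] c * n + sum (λ i → w i * weight (e i) S) ≤ c * t * ∣ S ∣ + sum w
  ∃-above-average {N} {zero} c w e = [] , ≤-reflexive
    (cong₂ _+_ (trans (*-zeroʳ c) (sym (*-zeroʳ (c * t)))) (sum-cong-≗ (λ i → p (w i) (e i))))
    where
    p : ∀ w (e : Subset 0) → w * weight e [] ≡ w
    p w [] = *-identityʳ w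
  ∃-above-average {N} {suc n} c w e = [ with-head , without-head ]′ (≤-total W₁ c)
    where
    open ≤-Reasoning
    m : Fin N → ℕ
    m i = mark (head (e i)) (w i)
    W₁ = sum m
    -- Once the first point is decided, its factor is absorbed into the coefficient of each edge.
    -- The recursion therefore needs arbitrary coefficients `w`.
    w′ : Side → Fin N → ℕ
    w′ s i = w i * factor (head (e i)) s
    IH : ∀ s → _
    IH s = ∃-above-average c (w′ s) (tail ∘ e)
    S : Side → Subset n
    S s = proj₁ (IH s)
    V : Side → ℕ
    V s = sum (λ i → w′ s i * weight (tail (e i)) (S s))
    weight-head : ∀ s → sum (λ i → w i * weight (e i) (s ∷ S s)) ≡ V s
    weight-head s = sum-cong-≗ (λ i → q (w i) (e i))
      where
      q : ∀ w e → w * weight e (s ∷ S s) ≡ w * factor (head e) s * weight (tail e) (S s)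
      q w (b ∷ e) = sym (*-assoc w (factor b s) (weight e (S s)))

    with-head : W₁ ≤ c → _
    with-head W₁≤c = inside ∷ S inside , +-cancelʳ-≤ (t * W₁) _ _ (begin
      c * suc n + sum (λ i → w i * weight (e i) (inside ∷ S inside)) + t * W₁
        ≡⟨ cong (λ z → c * suc n + z + t * W₁) (weight-head inside) ⟩
      c * suc n + V inside + t * W₁           ≡⟨ p c n (V inside) (t * W₁) ⟩
      (c * n + V inside) + (c + t * W₁)       ≤⟨ +-mono-≤ (proj₂ (IH inside)) q ⟩
      (c * t * k + sum (w′ inside)) + (c * t + W₁) ≡⟨ r (c * t) k (sum (w′ inside)) W₁ ⟩
      c * t * suc k + (sum (w′ inside) + W₁)  ≡⟨ cong (c * t * suc k +_) total ⟩
      c * t * suc k + (sum w + t * W₁)        ≡⟨ +-assoc (c * t * suc k) (sum w) (t * W₁) ⟨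
      c * t * suc k + sum w + t * W₁          ∎)
      where
      k = ∣ S inside ∣
      total : sum (w′ inside) + W₁ ≡ sum w + t * W₁
      total = begin-equality
        sum (w′ inside) + W₁            ≡⟨ ∑-distrib-+ (w′ inside) m ⟨
        sum (λ i → w′ inside i + m i)   ≡⟨ sum-cong-≗ (λ i → factor-inside (head (e i)) (w i)) ⟩
        sum (λ i → w i + t * m i)       ≡⟨ ∑-distrib-+ w (λ i → t * m i) ⟩
        sum w + sum (λ i → t * m i)     ≡⟨ cong (sum w +_) (*-distribˡ-sum t m) ⟨
        sum w + t * W₁                  ∎
      p : ∀ c n V x → c * suc n + V + x ≡ (c * n + V) + (c + x)
      p = solve-∀
      q₁ : ∀ c u x → c + x + u * x ≡ c + suc u * x
      q₁ = solve-∀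
      q₂ : ∀ c u x → c + x + u * c ≡ c * suc u + x
      q₂ = solve-∀
      -- With `c + W₁` removed from both sides this is `t′ * W₁ ≤ t′ * c`: the gain over the
      -- expectation from keeping the point covers the growth of the edge weights.
      q : c + t * W₁ ≤ c * t + W₁
      q = subst₂ _≤_ (q₁ c t′ W₁) (q₂ c t′ W₁) (+-monoʳ-≤ (c + W₁) (*-monoʳ-≤ t′ W₁≤c))
      r : ∀ x y z w → (x * y + z) + (x + w) ≡ x * suc y + (z + w)
      r = solve-∀

    without-head : c ≤ W₁ → _
    without-head c≤W₁ = outside ∷ S outside , (begin
      c * suc n + sum (λ i → w i * weight (e i) (outside ∷ S outside))
        ≡⟨ cong (c * suc n +_) (weight-head outside) ⟩
      c * suc n + V outside                   ≡⟨ p c n (V outside) ⟩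
      (c * n + V outside) + c                 ≤⟨ +-mono-≤ (proj₂ (IH outside)) c≤W₁ ⟩
      (c * t * k + sum (w′ outside)) + W₁     ≡⟨ +-assoc (c * t * k) (sum (w′ outside)) W₁ ⟩
      c * t * k + (sum (w′ outside) + W₁)     ≡⟨ cong (c * t * k +_) total ⟩
      c * t * k + sum w                       ∎)
      where
      k = ∣ S outside ∣
      total : sum (w′ outside) + W₁ ≡ sum w
      total = trans (sym (∑-distrib-+ (w′ outside) m))
        (sum-cong-≗ (λ i → factor-outside (head (e i)) (w i)))
      p : ∀ c n V → c * suc n + V ≡ (c * n + V) + c
      p = solve-∀

-- Deleting a point from every surviving edge.

∣p∣≤1+∣p-x∣ : ∀ (p : Subset n) x → ∣ p ∣ ≤ suc ∣ p - x ∣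
∣p∣≤1+∣p-x∣ (s ∷ p) zero = subst (λ q → ∣ s ∷ p ∣ ≤ suc ∣ q ∣) (sym (p─⊥≡p p)) (side s)
  where
  side : ∀ s → ∣ s ∷ p ∣ ≤ suc ∣ p ∣
  side inside = ≤-refl
  side outside = n≤1+n _
∣p∣≤1+∣p-x∣ (inside ∷ p) (suc x) = s≤s (∣p∣≤1+∣p-x∣ p x)
∣p∣≤1+∣p-x∣ (outside ∷ p) (suc x) = ∣p∣≤1+∣p-x∣ p x

x∉p-x : ∀ (p : Subset n) x → ¬ x ∈ p - x
x∉p-x (s ∷ p) (suc x) (there x∈) = x∉p-x p x x∈

0<∣p∣⇒nonempty : (p : Subset n) → 0 < ∣ p ∣ → Nonempty p
0<∣p∣⇒nonempty {n} p 0<∣p∣ with nonempty? p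
... | yes ne = ne
... | no ¬ne rewrite Empty-unique ¬ne | ∣⊥∣≡0 n = contradiction 0<∣p∣ λ ()

-- Each deletion is charged to the edge that forces it, whose weight is at least `t ^ suc k`.
-- Weights are taken in the original `S`, so earlier deletions do not change them; `S′ ⊆ₛ S` shows
-- that an edge inside `S′` has its full weight in `S`.
delete-edges : ∀ t′ k (e : Fin N → Subset n) S → let t = suc t′ in
  ∃[ S′ ] S′ ⊆ₛ S × (∀ i → k < ∣ e i ∣ → e i ⊈ₛ S′) ×
    t ^ suc k * ∣ S ∣ ≤ t ^ suc k * ∣ S′ ∣ + sum (λ i → weight t′ (e i) S)
delete-edges {zero} t′ k e S = S , ⊆-refl , (λ ()) , ≤-reflexive (sym (+-identityʳ _))
delete-edges {suc N} t′ k e S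
  with S′ , S′⊆S , free , bound ← delete-edges t′ k (e ∘ suc) S
  with k <? ∣ e zero ∣ | e zero ⊆? S′
... | no k≮ | _ = S′ , S′⊆S , free′ , ≤-trans bound (+-monoʳ-≤ (suc t′ ^ suc k * ∣ S′ ∣) (m≤n+m _ _))
  where
  free′ : ∀ i → k < ∣ e i ∣ → e i ⊈ₛ S′
  free′ zero k< = contradiction k< k≮
  free′ (suc i) = free i
... | yes _ | no ⊈ = S′ , S′⊆S , free′ , ≤-trans bound (+-monoʳ-≤ (suc t′ ^ suc k * ∣ S′ ∣) (m≤n+m _ _))
  where
  free′ : ∀ i → k < ∣ e i ∣ → e i ⊈ₛ S′
  free′ zero _ = ⊈
  free′ (suc i) = free i
... | yes k< | yes ⊆S′ = S′ - x , ⊆-trans -⊆ S′⊆S , free′ , (begin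
    T * ∣ S ∣                               ≤⟨ bound ⟩
    T * ∣ S′ ∣ + Σweight                       ≤⟨ +-monoˡ-≤ Σweight (*-monoʳ-≤ T (∣p∣≤1+∣p-x∣ S′ x)) ⟩
    T * suc ∣ S′ - x ∣ + Σweight               ≡⟨ p T ∣ S′ - x ∣ Σweight ⟩
    T * ∣ S′ - x ∣ + (T + Σweight)             ≤⟨ +-monoʳ-≤ (T * ∣ S′ - x ∣) (+-monoˡ-≤ Σweight T≤weight) ⟩
    T * ∣ S′ - x ∣ + (weight t′ (e zero) S + Σweight) ∎)
  where
  open ≤-Reasoning
  T = suc t′ ^ suc k
  Σweight = sum (λ i → weight t′ (e (suc i)) S)
  ne = 0<∣p∣⇒nonempty (e zero) (≤-trans (s≤s z≤n) k<)
  x = proj₁ ne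
  -⊆ : S′ - x ⊆ₛ S′
  -⊆ = p─q⊆p S′ _
  free′ : ∀ i → k < ∣ e i ∣ → e i ⊈ₛ S′ - x
  free′ zero _ ⊆- = x∉p-x S′ x (⊆- (proj₂ ne))
  free′ (suc i) k<∣eᵢ∣ ⊆- = free i k<∣eᵢ∣ (⊆-trans ⊆- -⊆)
  T≤weight : T ≤ weight t′ (e zero) S
  T≤weight = ≤-trans (^-monoʳ-≤ (suc t′) k<)
    (≤-reflexive (sym (weight-⊆ t′ (e zero) S (⊆-trans ⊆S′ S′⊆S))))
  p : ∀ x y z → x * suc y + z ≡ x * y + (x + z)
  p = solve-∀

∃-independent : ∀ t k → .{{NonZero t}} → (e : Fin N → Subset n) →
  ∃[ S ] (∀ i → k < ∣ e i ∣ → e i ⊈ₛ S) × t ^ k * n ≤ t ^ suc k * ∣ S ∣ + N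
∃-independent {N} {n} t@(suc t′) k e
  -- The choice `c = t ^ k` values each point of `S` at `t ^ suc k`, the price of one deletion in
  -- `delete-edges`, so the total weight of the edges cancels.
  with S , good ← ∃-above-average t′ (t ^ k) (λ _ → 1) e
  with S′ , _ , free , bound ← delete-edges t′ k e S
  = S′ , free , +-cancelʳ-≤ Σweight _ _ (begin
    t ^ k * n + Σweight          ≡⟨ cong (t ^ k * n +_) (sum-cong-≗ λ i → *-identityˡ (weight t′ (e i) S)) ⟨
    t ^ k * n + sum (λ i → 1 * weight t′ (e i) S) ≤⟨ good ⟩
    t ^ k * t * ∣ S ∣ + sum {N} (λ _ → 1)  ≡⟨ cong₂ (λ a b → a * ∣ S ∣ + b) (*-comm (t ^ k) t) (sum-1 N) ⟩
    t ^ suc k * ∣ S ∣ + N     ≤⟨ +-monoˡ-≤ N bound ⟩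
    t ^ suc k * ∣ S′ ∣ + Σweight + N  ≡⟨ p (t ^ suc k * ∣ S′ ∣) Σweight N ⟩
    t ^ suc k * ∣ S′ ∣ + N + Σweight  ∎)
  where
  open ≤-Reasoning
  Σweight = sum (λ i → weight t′ (e i) S)
  p : ∀ x y z → x + y + z ≡ x + z + y
  p = solve-∀

-- Enumerating, counting and filtering finite subsets.

enumerate : (S : Subset n) → Fin ∣ S ∣ → Fin n
enumerate (inside ∷ S) zero = zero
enumerate (inside ∷ S) (suc i) = suc (enumerate S i)
enumerate (outside ∷ S) i = suc (enumerate S i)

enumerate-∈ : (S : Subset n) (i : Fin ∣ S ∣) → enumerate S i ∈ S
enumerate-∈ (inside ∷ S) zero = here
enumerate-∈ (inside ∷ S) (suc i) = there (enumerate-∈ S i)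
enumerate-∈ (outside ∷ S) i = there (enumerate-∈ S i)

enumerate-injective : (S : Subset n) → Injective _≡_ _≡_ (enumerate S)
enumerate-injective (inside ∷ S) {zero} {zero} _ = refl
enumerate-injective (inside ∷ S) {suc i} {suc j} eq = cong suc (enumerate-injective S (suc-injective eq))
enumerate-injective (outside ∷ S) eq = enumerate-injective S (suc-injective eq)

enumerate-surjective : (S : Subset n) {x : Fin n} → x ∈ S → ∃[ i ] enumerate S i ≡ x
enumerate-surjective (inside ∷ S) here = zero , refl
enumerate-surjective (inside ∷ S) (there x∈S) with i , eq ← enumerate-surjective S x∈S = suc i , cong suc eq
enumerate-surjective (outside ∷ S) (there x∈S) with i , eq ← enumerate-surjective S x∈S = i , cong suc eq

injective⇒≤∣p∣ : (S : Subset n) (f : Fin N → Fin n) → Injective _≡_ _≡_ f → (∀ i → f i ∈ S) → N ≤ ∣ S ∣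
injective⇒≤∣p∣ S f f-injective f∈S = injective⇒≤ {f = index} λ {i} {j} eq →
  f-injective (trans (sym (proj₂ (pre i))) (trans (cong (enumerate S) eq) (proj₂ (pre j))))
  where
  pre : ∀ i → ∃[ j ] enumerate S j ≡ f i
  pre i = enumerate-surjective S (f∈S i)
  index : Fin _ → Fin ∣ S ∣
  index i = proj₁ (pre i)

filter : {P : Pred (Fin n) 0ℓ} → (∀ x → Dec (P x)) → Subset n
filter P? = tabulate (does ∘ P?)

∈-filter⁺ : {P : Pred (Fin n) 0ℓ} (P? : ∀ x → Dec (P x)) → ∀ {x} → P x → x ∈ filter P?
∈-filter⁺ P? {x} px = lookup⇒[]= x (filter P?) (trans (lookup∘tabulate (does ∘ P?) x) (dec-true (P? x) px))

∈-filter⁻ : {P : Pred (Fin n) 0ℓ} (P? : ∀ x → Dec (P x)) → ∀ {x} → x ∈ filter P? → P x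
∈-filter⁻ P? {x} x∈ with P? x | trans (sym (lookup∘tabulate (does ∘ P?) x)) ([]=⇒lookup x∈)
... | yes px | _ = px

-- Powers, integer roots and the numerical bound.

^-cancelʳ-≤ : ∀ k .{{_ : NonZero k}} {a b} → a ^ k ≤ b ^ k → a ≤ b
^-cancelʳ-≤ k aᵏ≤bᵏ = ≮⇒≥ λ b<a → <⇒≱ (^-monoˡ-< k b<a) aᵏ≤bᵏ

^-comm : ∀ a m k → (a ^ m) ^ k ≡ (a ^ k) ^ m
^-comm a m k = trans (^-*-assoc a m k) (trans (cong (a ^_) (*-comm m k)) (sym (^-*-assoc a k m)))

^-distribʳ-* : ∀ k a b → (a * b) ^ k ≡ a ^ k * b ^ k
^-distribʳ-* zero a b = refl
^-distribʳ-* (suc k) a b = trans (cong (a * b *_) (^-distribʳ-* k a b)) (p a b (a ^ k) (b ^ k))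
  where
  p : ∀ a b x y → a * b * (x * y) ≡ a * x * (b * y)
  p = solve-∀

-- When `N` grows by one, the least base whose `k`-th power reaches it grows by at most one. That
-- least base is `suc y`.
∃-root : ∀ k .{{_ : NonZero k}} N → 1 ≤ N → ∃[ y ] y ^ k < N × N ≤ suc y ^ k
∃-root (suc k) 1 _ = 0 , s≤s z≤n , m^n>0 1 (suc k)
∃-root k (suc N@(suc _)) _ with y , yᵏ<N , N≤ ← ∃-root k N (s≤s z≤n) with N <? suc y ^ k
... | yes N< = y , m<n⇒m<1+n yᵏ<N , N<
... | no N≮ = suc y , s≤s (≮⇒≥ N≮) , ≤-<-trans N≤ (^-monoˡ-< k ≤-refl)

-- Put `t = suc y`. Since `2 * n ^ s ≤ t ^ k`, the term `n ^ suc s` is at most half of `t ^ k * n`,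
-- whence `n ≤ 2 * t * m`. The constant 8 collects three factors 2: from this halving, from
-- `t ≤ 2 * y` and from `2 ≤ 2 ^ k`.
power-bound : ∀ n .{{_ : NonZero n}} p s k .{{_ : NonZero k}} m y .{{_ : NonZero y}} → k ≡ p + s →
  y ^ k < 2 * n ^ s → 2 * n ^ s ≤ suc y ^ k →
  suc y ^ k * n ≤ suc y ^ suc k * m + n ^ suc s →
  n ^ p ≤ (8 * m) ^ k
power-bound n p s k m y@(suc _) refl yᵏ< ≤tᵏ bound = *-cancelʳ-≤ _ _ (n ^ s) {{m^n≢0 n s}} (begin
  n ^ p * n ^ s                ≡⟨ ^-distribˡ-+-* n p s ⟨
  n ^ k                        ≤⟨ ^-monoˡ-≤ k n≤ ⟩
  (4 * m * y) ^ k              ≡⟨ ^-distribʳ-* k (4 * m) y ⟩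
  (4 * m) ^ k * y ^ k          ≤⟨ *-monoʳ-≤ ((4 * m) ^ k) (<⇒≤ yᵏ<) ⟩
  (4 * m) ^ k * (2 * n ^ s)    ≤⟨ *-monoʳ-≤ ((4 * m) ^ k) (*-monoˡ-≤ (n ^ s) 2≤2ᵏ) ⟩
  (4 * m) ^ k * (2 ^ k * n ^ s) ≡⟨ *-assoc ((4 * m) ^ k) (2 ^ k) (n ^ s) ⟨
  (4 * m) ^ k * 2 ^ k * n ^ s  ≡⟨ cong (_* n ^ s) (^-distribʳ-* k (4 * m) 2) ⟨
  (4 * m * 2) ^ k * n ^ s      ≡⟨ cong (λ z → z ^ k * n ^ s) (e₃ m) ⟩
  (8 * m) ^ k * n ^ s          ∎)
  where
  open ≤-Reasoning
  t = suc y
  2≤2ᵏ : 2 ≤ 2 ^ k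
  2≤2ᵏ = ^-monoʳ-≤ 2 (>-nonZero⁻¹ k)
  e₁ : ∀ T n → 2 * (T * n) ≡ T * n + T * n
  e₁ = solve-∀
  e₂ : ∀ T t m → 2 * (t * T * m) ≡ T * (2 * t * m)
  e₂ = solve-∀
  e₃ : ∀ m → 4 * m * 2 ≡ 8 * m
  e₃ = solve-∀
  e₄ : ∀ y m → 2 * (y + y) * m ≡ 4 * m * y
  e₄ = solve-∀
  e₅ : ∀ n x → 2 * (n * x) ≡ 2 * x * n
  e₅ = solve-∀
  n≤2tm : n ≤ 2 * t * m
  n≤2tm = *-cancelˡ-≤ (t ^ k) {{m^n≢0 t k}} (+-cancelʳ-≤ (t ^ k * n) _ _ (begin
    t ^ k * n + t ^ k * n                       ≡⟨ e₁ (t ^ k) n ⟨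
    2 * (t ^ k * n)                             ≤⟨ *-monoʳ-≤ 2 bound ⟩
    2 * (t ^ suc k * m + n ^ suc s)             ≡⟨ *-distribˡ-+ 2 (t ^ suc k * m) (n ^ suc s) ⟩
    2 * (t ^ suc k * m) + 2 * n ^ suc s         ≡⟨ cong₂ _+_ (e₂ (t ^ k) t m) (e₅ n (n ^ s)) ⟩
    t ^ k * (2 * t * m) + 2 * n ^ s * n         ≤⟨ +-monoʳ-≤ (t ^ k * (2 * t * m)) (*-monoˡ-≤ n ≤tᵏ) ⟩
    t ^ k * (2 * t * m) + t ^ k * n             ∎))
  n≤ : n ≤ 4 * m * y
  n≤ = begin
    n                ≤⟨ n≤2tm ⟩
    2 * t * m        ≤⟨ *-monoˡ-≤ m (*-monoʳ-≤ 2 (+-monoˡ-≤ y {1} {y} (s≤s z≤n))) ⟩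
    2 * (y + y) * m  ≡⟨ e₄ y m ⟩
    4 * m * y        ∎

-- Evaluating the rational exponent.

-- Raise the hypothesis to the power `suc q′`, change the exponent of `b` by cross multiplication,
-- and cancel the common power `suc q`.
^ℚ-≃ : ∀ {b y p q} r → r ℚᵘ.≃ mkℚᵘ (ℤ.+ p) q → b ^ p ≤ y ^ suc q → b ^ℚ r ≤ y
^ℚ-≃ {b} {y} {p} {q} (mkℚᵘ (ℤ.+ p′) q′) (*≡* eq) bᵖ≤ = ^-cancelʳ-≤ (suc q) (begin
  (b ^ p′) ^ suc q       ≡⟨ ^-*-assoc b p′ (suc q) ⟩
  b ^ (p′ * suc q)       ≡⟨ cong (b ^_) cross ⟩
  b ^ (p * suc q′)       ≡⟨ ^-*-assoc b p (suc q′) ⟨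
  (b ^ p) ^ suc q′       ≤⟨ ^-monoˡ-≤ (suc q′) bᵖ≤ ⟩
  (y ^ suc q) ^ suc q′   ≡⟨ ^-comm y (suc q) (suc q′) ⟩
  (y ^ suc q′) ^ suc q   ∎)
  where
  open ≤-Reasoning
  cross : p′ * suc q ≡ p * suc q′
  cross = ℤ.+-injective (trans (ℤ.pos-* p′ (suc q)) (trans eq (sym (ℤ.pos-* p (suc q′)))))
-- A negative numerator would make one cross product negative and the other nonnegative.
^ℚ-≃ {p = p} (mkℚᵘ -[1+ p′ ] q′) (*≡* eq) _ with () ← trans eq (sym (ℤ.pos-* p (suc q′)))

1-1/[1+m] : ∀ m → 1ℚᵘ ℚᵘ.- mkℚᵘ (ℤ.+ 1) m ℚᵘ.≃ mkℚᵘ (ℤ.+ m) m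
1-1/[1+m] m = *≡* (cong₂ ℤ._*_
  (cong (ℤ._+ -[1+ 0 ]) (ℤ.*-identityˡ (ℤ.+ suc m))) (cong ℤ.+_ (sym (*-identityˡ (suc m)))))

1+1/[1+m] : ∀ m → 1ℚᵘ ℚᵘ.+ mkℚᵘ (ℤ.+ 1) m ℚᵘ.≃ mkℚᵘ (ℤ.+ suc (suc m)) m
1+1/[1+m] m = *≡* (cong₂ ℤ._*_
  (trans (cong (ℤ._+ ℤ.+ 1) (ℤ.*-identityˡ (ℤ.+ suc m))) (cong ℤ.+_ (+-comm (suc m) 1)))
  (cong ℤ.+_ (sym (*-identityˡ (suc m)))))

*-collapse : ∀ x y a b d → mkℚᵘ (ℤ.+ x) a ℚᵘ.* mkℚᵘ (ℤ.+ y) b ℚᵘ.* mkℚᵘ (ℤ.+ (suc a * suc b)) d ℚᵘ.≃ mkℚᵘ (ℤ.+ (x * y)) d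
*-collapse x y a b d = *≡* (begin
  ℤ.+ x ℤ.* ℤ.+ y ℤ.* ℤ.+ z ℤ.* ℤ.+ suc d  ≡⟨ cong (λ w → w ℤ.* ℤ.+ z ℤ.* ℤ.+ suc d) (ℤ.pos-* x y) ⟨
  ℤ.+ (x * y) ℤ.* ℤ.+ z ℤ.* ℤ.+ suc d    ≡⟨ ℤ.*-assoc (ℤ.+ (x * y)) (ℤ.+ z) (ℤ.+ suc d) ⟩
  ℤ.+ (x * y) ℤ.* (ℤ.+ z ℤ.* ℤ.+ suc d)  ≡⟨ cong (ℤ.+ (x * y) ℤ.*_) (ℤ.pos-* z (suc d)) ⟨
  ℤ.+ (x * y) ℤ.* ℤ.+ (z * suc d)      ∎)
  where
  open ≡-Reasoning
  z = suc a * suc b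

-- The factor 1 + 1/(hg - 1) = hg/(hg - 1) cancels the denominators h and g, leaving (h - 1)(g -
-- 1)/(hg - 1). As `mkℚᵘ` stores the predecessor of the denominator, its second argument is hg - 2.
exponent-≃ : ∀ a b 2≤h h≤g → let h = suc (suc a); g = suc (suc b) in
  exponent h g 2≤h h≤g ℚᵘ.≃ mkℚᵘ (ℤ.+ (suc a * suc b)) (b + suc a * g)
exponent-≃ a b _ _ = ℚᵘ.≃-trans
  (ℚᵘ.*-cong (ℚᵘ.*-cong (1-1/[1+m] (suc a)) (1-1/[1+m] (suc b))) (1+1/[1+m] (b + suc a * suc (suc b))))
  (*-collapse (suc a) (suc b) (suc a) (suc b) (b + suc a * suc (suc b)))

-- Grids and their borders.

-- The index `i` codes an arbitrary border of h + g - 1 points, where h is `suc H` and g is `suc G`;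
-- the corner is shared by `row` and `col`. The bound on the number of grids is thus built into the
-- index type. Borders of no genuine grid merely add edges.
module Grid (n H G : ℕ) (i : Fin (n ^ (suc H + G))) where
  u : Fin (suc H + G) → Fin n
  u = finToFun i

  row : Fin (suc H) → ℕ
  row x = toℕ (u (x ↑ˡ G))

  col : Fin (suc G) → ℕ
  col zero = row zero
  col (suc y) = toℕ (u (suc H ↑ʳ y))

  -- The fourth vertex of a parallelogram, `row x + col y - row zero`, expressed without
  -- subtraction.
  OnGrid : Pred (Fin n) 0ℓ
  OnGrid v = ∃[ x ] ∃[ y ] toℕ v + row zero ≡ row x + col y

  onGrid? : ∀ v → Dec (OnGrid v)
  onGrid? v = any? λ x → any? λ y → toℕ v + row zero ≟ row x + col y

  grid : Subset n
  grid = filter onGrid?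

open Grid using (grid)

module _ {n H G : ℕ} (P : Fin (suc H) → Fin (suc G) → Fin n)
  (parallelogram : ∀ x y → toℕ (P x y) + toℕ (P zero zero) ≡ toℕ (P x zero) + toℕ (P zero y)) where

  border : Fin (suc H + G) → Fin n
  border = [ (λ x → P x zero) , (λ y → P zero (suc y)) ]′ ∘ splitAt (suc H)

  open Grid n H G (funToFin border) hiding (grid)

  row-border : ∀ x → row x ≡ toℕ (P x zero)
  row-border x = cong toℕ (trans (finToFun-funToFin border (x ↑ˡ G))
    (cong [ (λ x → P x zero) , (λ y → P zero (suc y)) ]′ (splitAt-↑ˡ (suc H) x G)))

  col-border : ∀ y → col y ≡ toℕ (P zero y)
  col-border zero = row-border zero
  col-border (suc y) = cong toℕ (trans (finToFun-funToFin border (suc H ↑ʳ y))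
    (cong [ (λ x → P x zero) , (λ y → P zero (suc y)) ]′ (splitAt-↑ʳ (suc H) G y)))

  on-grid : ∀ x y → toℕ (P x y) + row zero ≡ row x + col y
  on-grid x y = trans (cong (toℕ (P x y) +_) (row-border zero)) (trans (parallelogram x y)
    (sym (cong₂ _+_ (row-border x) (col-border y))))

  ∈-grid⁺ : ∀ x y → P x y ∈ grid n H G (funToFin border)
  ∈-grid⁺ x y = ∈-filter⁺ onGrid? (x , y , on-grid x y)

  -- For given `x` and `y` the equation of `OnGrid` has a single solution, and `P x y` is one by
  -- `on-grid`.
  ∈-grid⁻ : ∀ {v} → v ∈ grid n H G (funToFin border) → ∃[ x ] ∃[ y ] v ≡ P x y
  ∈-grid⁻ v∈ = let x , y , eq = ∈-filter⁻ onGrid? v∈ in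
    x , y , toℕ-injective (+-cancelʳ-≡ (row zero) _ _ (trans eq (sym (on-grid x y))))

-- From subsets of `Fin n` to weak sets in ℤ.

embed : Fin n → ℤ
embed v = ℤ.+ suc (toℕ v)

embed-injective : {u v : Fin n} → embed u ≡ embed v → u ≡ v
embed-injective eq = toℕ-injective (ℤ.+[1+-injective eq)

Image : Subset n → Pred ℤ 0ℓ
Image S z = ∃[ v ] v ∈ S × z ≡ embed v

image? : (S : Subset n) → ∀ z → Dec (Image S z)
image? S z = any? λ v → v ∈? S ×-dec z ℤ.≟ embed v

image⊆[1⋯n] : (S : Subset n) → Image S ⊆ [1⋯ n ]
image⊆[1⋯n] S (v , _ , refl) = ℤ.+≤+ (s≤s z≤n) , ℤ.+≤+ (toℕ<n v)

image-size : (S : Subset n) → HasSize +-0-abelianGroup (Image S) ∣ S ∣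
image-size S = embed ∘ enumerate S , enumerate-injective S ∘ embed-injective , λ z → mk⇔
  (λ { (v , v∈S , refl) → let i , eq = enumerate-surjective S v∈S in i , cong embed (sym eq) })
  (λ { (i , refl) → enumerate S i , enumerate-∈ S i , refl })

image-weakC : (S : Subset n) →
  (∀ i → G + H * suc G < ∣ grid n H G i ∣ → grid n H G i ⊈ₛ S) →
  IsWeakC +-0-abelianGroup (suc H) (suc G) (Image S)
image-weakC {n} {G} {H} S free X (f , f-injective , X⇔) k _ disjoint =
  -- A specific translate can be named because membership in `Image S` is decidable and both index
  -- ranges are finite.
  let i , ¬all = ¬∀⟶∃¬ (suc G) _ (λ y → all? λ x → image? S (f x ℤ.+ k y)) ¬contained
  in i , λ X+k⊆A → ¬all λ x → X+k⊆A (f x , f∈X x , refl)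
  where
  f∈X : ∀ x → X (f x)
  f∈X x = Equivalence.from (X⇔ (f x)) (x , refl)

  ¬contained : ¬ (∀ y x → Image S (f x ℤ.+ k y))
  ¬contained f+k∈ = free (funToFin (border P parallelogram)) large contained
    where
    P : Fin (suc H) → Fin (suc G) → Fin n
    P x y = proj₁ (f+k∈ y x)

    f+k≡P : ∀ x y → f x ℤ.+ k y ≡ embed (P x y)
    f+k≡P x y = proj₂ (proj₂ (f+k∈ y x))

    exchange : ∀ a b c d → (a ℤ.+ b) ℤ.+ (c ℤ.+ d) ≡ (a ℤ.+ d) ℤ.+ (c ℤ.+ b)
    exchange = ℤ-Solver.solve-∀

    parallelogram : ∀ x y → toℕ (P x y) + toℕ (P zero zero) ≡ toℕ (P x zero) + toℕ (P zero y)
    -- `embed` shifts each point by one, so both sides carry an extra 2.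
    parallelogram x y = +-cancelˡ-≡ 2 _ _ (trans (sym (cong suc (+-suc _ _))) (trans (ℤ.+-injective
      (subst₂ _≡_ (cong₂ ℤ._+_ (f+k≡P x y) (f+k≡P zero zero)) (cong₂ ℤ._+_ (f+k≡P x zero) (f+k≡P zero y))
        (exchange (f x) (k y) (f zero) (k zero)))) (cong suc (+-suc _ _))))

    P-injective : ∀ x y x′ y′ → P x y ≡ P x′ y′ → x ≡ x′ × y ≡ y′
    P-injective x y x′ y′ eq with y ≟ᶠ y′ | trans (f+k≡P x y) (trans (cong embed eq) (sym (f+k≡P x′ y′)))
    -- Coinciding points of two different translates contradict disjointness; within one translate,
    -- `k y` cancels.
    ... | no y≢y′  | sums = contradiction ((f x , f∈X x , refl) , (f x′ , f∈X x′ , sums)) (disjoint y y′ y≢y′)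
    ... | yes refl | sums = f-injective (ℤ-Group.∙-cancelʳ (k y) _ _ sums) , refl

    large : G + H * suc G < ∣ grid n H G (funToFin (border P parallelogram)) ∣
    -- By computation `suc (G + H * suc G)` is `suc H * suc G`, the number of pairs of coordinates.
    large = injective⇒≤∣p∣ _ (uncurry P ∘ remQuot {suc H} (suc G))
      (λ {i} {j} eq → let x≡ , y≡ = P-injective _ _ _ _ eq in
        trans (sym (combine-remQuot {suc H} (suc G) i))
          (trans (cong₂ combine x≡ y≡) (combine-remQuot {suc H} (suc G) j)))
      (λ i → ∈-grid⁺ P parallelogram _ _)

    contained : grid n H G (funToFin (border P parallelogram)) ⊆ₛ S
    contained v∈ = let x , y , v≡ = ∈-grid⁻ P parallelogram v∈ in
      subst (_∈ S) (sym v≡) (proj₁ (proj₂ (f+k∈ y x)))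

-- Choice of the sampling rate and conclusion.

∃-large-weakC : ∀ n .{{_ : NonZero n}} H G → let k = G + H * suc G in .{{_ : NonZero k}} →
  Σ[ S ∈ Subset n ] IsWeakC +-0-abelianGroup (suc H) (suc G) (Image S) × n ^ (H * G) ≤ (8 * ∣ S ∣) ^ k
∃-large-weakC n H G = let y , yᵏ< , ≤tᵏ = ∃-root k (2 * n ^ s) 1≤2nˢ in from-root y yᵏ< ≤tᵏ
  where
  k = G + H * suc G
  s = H + G
  2≤2nˢ : 2 ≤ 2 * n ^ s
  2≤2nˢ = *-monoʳ-≤ 2 (m^n>0 n s)
  1≤2nˢ : 1 ≤ 2 * n ^ s
  1≤2nˢ = ≤-trans (s≤s z≤n) 2≤2nˢ
  k≡ : ∀ H G → G + H * suc G ≡ H * G + (H + G)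
  k≡ = solve-∀

  from-root : ∀ y → y ^ k < 2 * n ^ s → 2 * n ^ s ≤ suc y ^ k →
    Σ[ S ∈ Subset n ] IsWeakC +-0-abelianGroup (suc H) (suc G) (Image S) × n ^ (H * G) ≤ (8 * ∣ S ∣) ^ k
  -- Here `t` would be 1, but `1 ^ k` is less than 2. Excluding this case gives `power-bound` its
  -- positive `y`.
  from-root zero _ ≤1ᵏ = contradiction (≤-trans 2≤2nˢ (≤-trans ≤1ᵏ (≤-reflexive (^-zeroˡ k)))) λ { (s≤s ()) }
  -- The family has `n ^ (suc H + G)` grids, which is the term `n ^ suc s` of `power-bound`.
  from-root y@(suc _) yᵏ< ≤tᵏ = let S , free , bound = ∃-independent (suc y) k (grid n H G) in
    S , image-weakC S free , power-bound n (H * G) s k ∣ S ∣ y (k≡ H G) yᵏ< ≤tᵏ bound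

theorem4 : (h g n : ℕ) (2≤h : 2 ≤ h) (h≤g : h ≤ g) → 1 ≤ n →
    Σ[ A ∈ Pred ℤ 0ℓ ] ∃[ m ]
    A ⊆ [1⋯ n ] ×
    IsWeakC +-0-abelianGroup h g A ×
    HasSize +-0-abelianGroup A m ×
    (n ^ℚ exponent h g 2≤h h≤g ≤ (8 * m))
theorem4 1 _ _ (s≤s ()) _ _
theorem4 (suc (suc _)) 1 _ _ (s≤s ()) _
theorem4 h@(suc (suc a)) g@(suc (suc b)) n 2≤h h≤g 1≤n =
  let S , weakC , bound = ∃-large-weakC n {{>-nonZero 1≤n}} (suc a) (suc b) in
  Image S , ∣ S ∣ , image⊆[1⋯n] S , weakC , image-size S ,
  ^ℚ-≃ {n} {8 * ∣ S ∣} (exponent h g 2≤h h≤g) (exponent-≃ a b 2≤h h≤g) bound
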